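{- Every generalized Petersen graph $GP(k,2)$ with $k \ge 5$ contains an induced claw. Moreover, for every $k \ge 5$ divisible by $5$, $$\gamma(GP(k,2)) = \gamma_e(GP(k,2)) = \tfrac{3}{5}k.$$
   Context: Graphs are finite, simple and undirected. For $k \ge 5$, the graph $GP(k,2)$ has the $2k$ vertices $u_0,\dots,u_{k-1},v_0,\dots,v_{k-1}$ and the edges $u_iu_{i+1}$, $u_iv_i$ and $v_iv_{i+2}$ for all $i$, with indices modulo $k$. A claw is the complete bipartite graph $K_{1,3}$. The domination number $\gamma(G)$ is the minimum size of a set $S$ of vertices such that every vertex outside $S$ has a neighbour in $S$. A matching is a set of edges no two of which share a vertex; it is maximal if no edge of $G$ can be added to it. The edge domination number $\gamma_e(G)$ is the minimum size of a maximal matching of $G$. -}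

module Defs where

open import Level using (0ℓ)
open import Data.Nat using (ℕ; suc; _+_; _∸_; _≤_; _<_; z≤n; s≤s; NonZero; >-nonZero)
open import Data.Nat.Properties using (≤-trans; <-trans; m≤m+n; +-monoˡ-<; m+n∸n≡m; m+[n∸m]≡n; ∸-monoˡ-<; ≮⇒≥; _<?_; +-comm; +-cancelˡ-≡; <-irrefl; m<m+n)
open import Data.Nat.DivMod using (_%_; _mod_; m<n⇒m%n≡m; %-congˡ; [m+n]%n≡m%n)
open import Data.Fin using (Fin; toℕ; splitAt)
open import Data.Fin.Properties using (toℕ<n; toℕ-fromℕ<)
open import Data.Fin.Subset using (Subset; _∈_; _∉_; ∣_∣)
open import Data.List using (List; _∷_; length)
open import Data.List.Relation.Unary.AllPairs using (AllPairs)
open import Data.Product using (∃; _×_; _,_)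
open import Data.Sum using (_⊎_; inj₁; inj₂)
open import Function.Bundles using (_⇔_)
open import Function.Definitions using (Injective)
open import Relation.Binary.Core using (Rel)
open import Relation.Binary.Definitions using (Symmetric)
open import Relation.Binary.PropositionalEquality using (_≡_; refl; sym; trans; cong; subst)
open import Relation.Binary.Construct.Closure.Symmetric using (SymClosure; fwd; bwd; symmetric)
open import Relation.Nullary using (¬_; yes; no)

record Graph : Set₁ where
  field
    order  : ℕ
    Adj    : Rel (Fin order) 0ℓ
    adj-sym    : Symmetric Adj
    adj-irrefl : ∀ {x} → ¬ Adj x x

  Vertex : Set
  Vertex = Fin order

open Graph using (order; Adj; Vertex)

-- The embedding both preserves and reflects adjacency.
InducedSubgraph : Graph → Graph → Set
InducedSubgraph H G =
  ∃ λ (f : Vertex H → Vertex G) →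
    Injective _≡_ _≡_ f × (∀ x y → Adj H x y ⇔ Adj G (f x) (f y))

data Across {m n : ℕ} : Rel (Fin m ⊎ Fin n) 0ℓ where
  across : ∀ {i j} → Across (inj₁ i) (inj₂ j)

CompleteBipartite : ℕ → ℕ → Graph
CompleteBipartite m n = record
  { order      = m + n
  ; Adj        = λ x y → SymClosure Across (splitAt m x) (splitAt m y)
  ; adj-sym    = symmetric Across
  ; adj-irrefl = λ {x} → irrefl (splitAt m x)
  }
  where
  irrefl : ∀ x → ¬ SymClosure (Across {m} {n}) x x
  irrefl _ (fwd ())
  irrefl _ (bwd ())

Claw : Graph
Claw = CompleteBipartite 1 3

HasInducedClaw : Graph → Set
HasInducedClaw G = InducedSubgraph Claw G

IsLeast : (ℕ → Set) → ℕ → Set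
IsLeast P n = P n × (∀ m → P m → n ≤ m)

IsDominating : (G : Graph) → Subset (order G) → Set
IsDominating G S = ∀ x → x ∉ S → ∃ λ y → y ∈ S × Adj G x y

-- IsDominationNumber G n reads γ(G) = n.
IsDominationNumber : Graph → ℕ → Set
IsDominationNumber G =
  IsLeast λ n → ∃ λ (S : Subset (order G)) → IsDominating G S × ∣ S ∣ ≡ n

-- Each undirected edge is represented twice, once per orientation.
record Edge (G : Graph) : Set where
  constructor edge
  field
    {src tgt} : Vertex G
    joined    : Adj G src tgt

_isEndOf_ : {G : Graph} → Vertex G → Edge G → Set
x isEndOf e = x ≡ Edge.src e ⊎ x ≡ Edge.tgt e

Disjoint : {G : Graph} → Edge G → Edge G → Set
Disjoint e f = ∀ x → ¬ (x isEndOf e × x isEndOf f)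

-- No edge is disjoint from itself or from its reversal, so a list satisfying
-- IsMatching has no repeated undirected edges and its length is the size of
-- the matching.  For the same reason IsMaximalMatching imposes no condition
-- on the edges already in the list.
IsMatching : (G : Graph) → List (Edge G) → Set
IsMatching G = AllPairs Disjoint

IsMaximalMatching : (G : Graph) → List (Edge G) → Set
IsMaximalMatching G M = IsMatching G M × (∀ e → ¬ IsMatching G (e ∷ M))

-- IsEdgeDominationNumber G n reads γₑ(G) = n.
IsEdgeDominationNumber : Graph → ℕ → Set
IsEdgeDominationNumber G =
  IsLeast λ n → ∃ λ (M : List (Edge G)) → IsMaximalMatching G M × length M ≡ n

pattern u i = inj₁ i
pattern v i = inj₂ i

module _ {k : ℕ} .{{_ : NonZero k}} where

  _⊕_ : Fin k → ℕ → Fin k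
  i ⊕ m = (toℕ i + m) mod k

  data Arc : Rel (Fin k ⊎ Fin k) 0ℓ where
    outer : ∀ {i j} → j ≡ i ⊕ 1 → Arc (u i) (u j)
    spoke : ∀ {i j} → i ≡ j     → Arc (u i) (v j)
    inner : ∀ {i j} → j ≡ i ⊕ 2 → Arc (v i) (v j)

  ⊕-fixpoint-free : ∀ m (i : Fin k) → 0 < m → m < k → ¬ i ≡ i ⊕ m
  ⊕-fixpoint-free m i 0<m m<k i≡i⊕m with (toℕ i + m) <? k
  ... | yes i+m<k = <-irrefl (trans eq (m<n⇒m%n≡m i+m<k)) (m<m+n (toℕ i) 0<m)
    where
    eq : toℕ i ≡ (toℕ i + m) % k
    eq = trans (cong toℕ i≡i⊕m) (toℕ-fromℕ< _)
  ... | no i+m≮k = <-irrefl m≡k m<k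
    where
    eq : toℕ i ≡ (toℕ i + m) % k
    eq = trans (cong toℕ i≡i⊕m) (toℕ-fromℕ< _)
    k≤i+m = ≮⇒≥ i+m≮k
    r = toℕ i + m ∸ k
    r+k≡i+m : r + k ≡ toℕ i + m
    r+k≡i+m = trans (+-comm r k) (m+[n∸m]≡n k≤i+m)
    r<k : r < k
    r<k = subst (r <_) (m+n∸n≡m k k)
            (∸-monoˡ-< (<-trans (+-monoˡ-< m (toℕ<n i)) (subst (_< k + k) (+-comm m k) (+-monoˡ-< k m<k))) k≤i+m)
    i≡r : toℕ i ≡ r
    i≡r = trans eq (trans (%-congˡ {o = k} (sym r+k≡i+m))
            (trans ([m+n]%n≡m%n r k) (m<n⇒m%n≡m r<k)))
    m≡k : m ≡ k
    m≡k = +-cancelˡ-≡ (toℕ i) m k (trans (sym r+k≡i+m) (cong (_+ k) (sym i≡r)))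

-- Vertices 0, …, k-1 are u₀, …, u_{k-1}; vertices k, …, 2k-1 are v₀, …, v_{k-1}.
GP₂ : (k : ℕ) → 5 ≤ k → Graph
GP₂ k 5≤k = record
  { order      = k + k
  ; Adj        = λ x y → SymClosure (Arc {k}) (splitAt k x) (splitAt k y)
  ; adj-sym    = symmetric Arc
  ; adj-irrefl = λ {x} → irrefl (splitAt k x)
  }
  where
  instance
    k≢0 : NonZero k
    k≢0 = >-nonZero (≤-trans (s≤s z≤n) 5≤k)

  arc-irrefl : ∀ x → ¬ Arc {k} x x
  arc-irrefl _ (outer {i} p) = ⊕-fixpoint-free 1 i (s≤s z≤n) (≤-trans (m≤m+n 2 3) 5≤k) p
  arc-irrefl _ (inner {i} p) = ⊕-fixpoint-free 2 i (s≤s z≤n) (≤-trans (m≤m+n 3 2) 5≤k) p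

  irrefl : ∀ x → ¬ SymClosure (Arc {k}) x x
  irrefl x (fwd a) = arc-irrefl x a
  irrefl x (bwd a) = arc-irrefl x a

{-# OPTIONS --safe #-}
module Submission where

-- The claw is u₁ with its neighbours u₀, u₂ and v₁.
--
-- For γ ≥ 3k/5, slide a window of four columns {uᵢ, vᵢ} around the cycle.  There is a potential of
-- the window that each new column increases by at most 5 times the number of chosen vertices in
-- that column, minus 3.  It returns to its initial value after k columns, so 3k ≤ 5|S|.
-- For γₑ ≥ 3k/5, each edge of a maximal matching touches 5 edges, itself included, and every one
-- of the 3k edges is touched.
-- When 5 ∣ k, reducing indices modulo 5 is a covering map onto the Petersen graph GP(5,2), and the
-- preimages of {u₀, v₂, v₃} and {u₃u₄, u₁v₁, v₀v₂} attain the bounds.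

open import Data.Nat using (ℕ; _≤_; _*_)
open import Data.Nat.DivMod using (_/_)
open import Data.Nat.Divisibility using (_∣_)
open import Data.Product using (_×_)
open import Defs

open import Data.Bool using (Bool; true; false; T; _∨_; if_then_else_)
open import Data.Bool.Properties using (T?)
open import Data.Fin as Fin using (Fin; zero; suc; toℕ; splitAt; join; combine; quotient; remainder; remQuot)
open import Data.Fin.Patterns using (0F; 1F; 2F; 3F; 4F)
open import Data.Fin.Properties using (toℕ<n; toℕ-fromℕ<; toℕ-injective; toℕ-combine; splitAt-join; join-splitAt; combine-remQuot; remQuot-combine; injective⇒≤; ¬∀⟶∃¬)
  renaming (_≟_ to _≟ᶠ_; all? to allᶠ?; any? to anyᶠ?)
open import Data.Fin.Subset using (Subset; inside; outside; ∣_∣)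
open import Data.List as List using (List; []; _∷_; length; applyUpTo; concatMap; tabulate)
open import Data.List.Membership.Propositional using (find) renaming (_∈_ to _∈ˡ_)
open import Data.List.Membership.Propositional.Properties using (∈-concatMap⁺; ∈-tabulate⁺; ∈-++⁺ˡ)
open import Data.List.Membership.Setoid.Properties using (index-injective)
open import Data.List.Properties using (length-++; length-tabulate)
open import Data.List.Relation.Unary.All as All using (All)
open import Data.List.Relation.Unary.All.Properties using (¬All⇒Any¬)
open import Data.List.Relation.Unary.AllPairs using (_∷_)
open import Data.List.Relation.Unary.AllPairs.Properties using (tabulate⁺)
open import Data.List.Relation.Unary.Any as Any using (here; there; index)
open import Data.Nat using (zero; suc; _+_; _∸_; _≤?_; s≤s; z≤n; NonZero; >-nonZero)
open import Data.Nat.Divisibility using (divides-refl)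
open import Data.Nat.DivMod using (_%_; _mod_; m%n<n; m<n⇒m%n≡m; %-distribˡ-+; m%n%n≡m%n; [m+n]%n≡m%n; [m+kn]%n≡m%n; m∣n⇒o%n%m≡o%m; m*n/n≡m; /-monoˡ-≤)
open import Data.Nat.ListAction using (sum)
open import Data.Nat.Properties
open import Data.Nat.Tactic.RingSolver using (solve-∀)
open import Data.Product as Product using (∃; _,_; proj₁; proj₂; uncurry)
open import Data.Sum as Sum using (_⊎_; inj₁; inj₂; [_,_]′)
open import Data.Sum.Properties using (≡-dec)
open import Data.Vec as Vec using (Vec; []; _∷_; _++_; lookup)
open import Data.Vec.Properties using ([]=⇒lookup; lookup⇒[]=; lookup-splitAt; lookup∘tabulate)
open import Function using (_∘_; mk⇔; Injective)
open import Relation.Binary.Construct.Closure.Symmetric using (SymClosure; fwd; bwd; symmetric)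
open import Relation.Binary.PropositionalEquality
open import Relation.Nullary using (¬_; Dec; no; contradiction)
open import Relation.Nullary.Decidable using (map′; _×-dec_; _⊎-dec_; _→-dec_; ¬?; toWitness; decidable-stable)

-- Vertices as row and column, and index arithmetic modulo `k`

Cell : ℕ → Set
Cell k = Fin k ⊎ Fin k

module _ {k : ℕ} .{{_ : NonZero k}} where

  toℕ-mod : ∀ n → toℕ (n mod k) ≡ n % k
  toℕ-mod n = toℕ-fromℕ< (m%n<n n k)

  %⇒mod : ∀ {m n} → m % k ≡ n % k → m mod k ≡ n mod k
  %⇒mod {m} {n} eq = toℕ-injective (trans (toℕ-mod m) (trans eq (sym (toℕ-mod n))))

  toℕ-mod-inverse : ∀ (i : Fin k) → toℕ i mod k ≡ i
  toℕ-mod-inverse i = toℕ-injective (trans (toℕ-mod (toℕ i)) (m<n⇒m%n≡m (toℕ<n i)))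

  mod-⊕ : ∀ n m → (n mod k) ⊕ m ≡ (n + m) mod k
  mod-⊕ n m = %⇒mod (begin
    (toℕ (n mod k) + m) % k    ≡⟨ cong (λ r → (r + m) % k) (toℕ-mod n) ⟩
    (n % k + m) % k            ≡⟨ %-distribˡ-+ (n % k) m k ⟩
    (n % k % k + m % k) % k    ≡⟨ cong (λ r → (r + m % k) % k) (m%n%n≡m%n n k) ⟩
    (n % k + m % k) % k        ≡⟨ %-distribˡ-+ n m k ⟨
    (n + m) % k                ∎)
    where open ≡-Reasoning

  mod-period : ∀ n q → (n + q * k) mod k ≡ n mod k
  mod-period n q = %⇒mod ([m+kn]%n≡m%n n q k)

  ⊕-assoc : ∀ (i : Fin k) m n → (i ⊕ m) ⊕ n ≡ i ⊕ (m + n)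
  ⊕-assoc i m n = trans (mod-⊕ (toℕ i + m) n) (cong (_mod k) (+-assoc (toℕ i) m n))

  ⊕-period : ∀ (i : Fin k) → i ⊕ k ≡ i
  ⊕-period i = trans (%⇒mod ([m+n]%n≡m%n (toℕ i) k)) (toℕ-mod-inverse i)

  infixl 6 _⊖_
  -- Subtraction as addition of the complement `k ∸ m`; it inverts `_⊕ m` as long as `m ≤ k`.
  _⊖_ : Fin k → ℕ → Fin k
  i ⊖ m = i ⊕ (k ∸ m)

  ⊕-⊖ : ∀ (i : Fin k) {m} → m ≤ k → (i ⊕ m) ⊖ m ≡ i
  ⊕-⊖ i {m} m≤k = trans (⊕-assoc i m (k ∸ m)) (trans (cong (i ⊕_) (m+[n∸m]≡n m≤k)) (⊕-period i))

  ⊖-⊕ : ∀ (i : Fin k) {m} → m ≤ k → (i ⊖ m) ⊕ m ≡ i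
  ⊖-⊕ i {m} m≤k = trans (⊕-assoc i (k ∸ m) m) (trans (cong (i ⊕_) (m∸n+n≡m m≤k)) (⊕-period i))

  ⊕-cancelʳ : ∀ {i j : Fin k} {m} → m ≤ k → i ⊕ m ≡ j ⊕ m → i ≡ j
  ⊕-cancelʳ {i} {j} {m} m≤k eq =
    trans (sym (⊕-⊖ i m≤k)) (trans (cong (_⊖ m) eq) (⊕-⊖ j m≤k))

join-injective : ∀ m n {x y : Fin m ⊎ Fin n} → join m n x ≡ join m n y → x ≡ y
join-injective m n {x} {y} eq =
  trans (sym (splitAt-join m n x)) (trans (cong (splitAt m) eq) (splitAt-join m n y))

module _ {k : ℕ} .{{_ : NonZero k}} {x y : Cell k} where

  join-adj⁺ : SymClosure Arc x y → SymClosure Arc (splitAt k (join k k x)) (splitAt k (join k k y))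
  join-adj⁺ = subst₂ (SymClosure Arc) (sym (splitAt-join k k x)) (sym (splitAt-join k k y))

  join-adj⁻ : SymClosure Arc (splitAt k (join k k x)) (splitAt k (join k k y)) → SymClosure Arc x y
  join-adj⁻ = subst₂ (SymClosure Arc) (splitAt-join k k x) (splitAt-join k k y)

-- Induced claw

module _ {k : ℕ} where

  private
    K : ℕ
    K = 5 + k

  clawCell : Fin 4 → Cell K
  clawCell 0F = u 1F
  clawCell 1F = u 0F
  clawCell 2F = u 2F
  clawCell 3F = v 1F

  -- A left inverse of `clawCell`, which makes the embedding injective; its values off the claw are
  -- arbitrary.
  clawIndex : Cell K → Fin 4
  clawIndex (u 0F) = 1F
  clawIndex (u 1F) = 0F
  clawIndex (u _)  = 2F
  clawIndex (v _)  = 3F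

  clawIndex-clawCell : ∀ x → clawIndex (clawCell x) ≡ x
  clawIndex-clawCell 0F = refl
  clawIndex-clawCell 1F = refl
  clawIndex-clawCell 2F = refl
  clawIndex-clawCell 3F = refl

  clawCell-adj : ∀ x y → Graph.Adj Claw x y → SymClosure (Arc {K}) (clawCell x) (clawCell y)
  clawCell-adj 0F 1F _ = bwd (outer refl)
  clawCell-adj 0F 2F _ = fwd (outer refl)
  clawCell-adj 0F 3F _ = fwd (spoke refl)
  clawCell-adj 1F 0F _ = fwd (outer refl)
  clawCell-adj 2F 0F _ = bwd (outer refl)
  clawCell-adj 3F 0F _ = bwd (spoke refl)
  clawCell-adj 0F 0F (fwd ())
  clawCell-adj 0F 0F (bwd ())
  clawCell-adj (suc _) (suc _) (fwd ())
  clawCell-adj (suc _) (suc _) (bwd ())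

  -- All index sums that occur are at most 3, below `5 + k`, so `⊕` computes without wrapping around
  -- and every absent arc is refuted by a clash of constructors.
  clawCell-arc : ∀ x y → Arc {K} (clawCell x) (clawCell y) → Graph.Adj Claw x y
  clawCell-arc 0F 0F (outer ())
  clawCell-arc 0F 1F (outer ())
  clawCell-arc 0F 2F _ = fwd across
  clawCell-arc 0F 3F _ = fwd across
  clawCell-arc 1F 0F _ = bwd across
  clawCell-arc 1F 1F (outer ())
  clawCell-arc 1F 2F (outer ())
  clawCell-arc 1F 3F (spoke ())
  clawCell-arc 2F 0F (outer ())
  clawCell-arc 2F 1F (outer ())
  clawCell-arc 2F 2F (outer ())
  clawCell-arc 2F 3F (spoke ())
  clawCell-arc 3F 0F ()
  clawCell-arc 3F 1F ()
  clawCell-arc 3F 2F ()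
  clawCell-arc 3F 3F (inner ())

GP₂-claw : ∀ k (5≤k : 5 ≤ k) → HasInducedClaw (GP₂ k 5≤k)
GP₂-claw k@.(5 + _) 5≤k@(s≤s (s≤s (s≤s (s≤s (s≤s z≤n))))) =
  (join k k ∘ clawCell)
  , (λ {x} {y} eq → trans (sym (clawIndex-clawCell x))
      (trans (cong clawIndex (join-injective k k eq)) (clawIndex-clawCell y)))
  , λ x y → mk⇔ (join-adj⁺ ∘ clawCell-adj x y) (reflects x y ∘ join-adj⁻ {x = clawCell x} {clawCell y})
  where
  reflects : ∀ x y → SymClosure Arc (clawCell x) (clawCell y) → Graph.Adj Claw x y
  reflects x y (fwd a) = clawCell-arc x y a
  reflects x y (bwd a) = symmetric Across (clawCell-arc y x a)

-- Domination number, lower bound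

bit : Bool → ℕ
bit b = if b then 1 else 0

-- 2F: in the set; 1F: not in the set, but one of the two given neighbours is; 0F: neither.
status : Bool → Bool → Bool → Fin 3
status true  _ _ = 2F
status false p q = if p ∨ q then 1F else 0F

-- The smallest solution in ℕ of the inequalities of windowSurplus-step, found by value iteration
-- over all triples of statuses; some entries belong to triples that no window produces.
surplus : Fin 3 → Fin 3 → Fin 3 → ℕ
surplus a b c = lookup (lookup (lookup table a) b) c
  where
  table : Vec (Vec (Vec ℕ 3) 3) 3
  table = ((0 ∷ 1 ∷ 1 ∷ []) ∷ (0 ∷ 4 ∷ 4 ∷ []) ∷ (3 ∷ 5 ∷ 5  ∷ []) ∷ [])
        ∷ ((3 ∷ 3 ∷ 3 ∷ []) ∷ (3 ∷ 4 ∷ 7 ∷ []) ∷ (5 ∷ 5 ∷ 7  ∷ []) ∷ [])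
        ∷ ((3 ∷ 6 ∷ 6 ∷ []) ∷ (3 ∷ 6 ∷ 7 ∷ []) ∷ (5 ∷ 6 ∷ 10 ∷ []) ∷ [])
        ∷ []

-- Later columns can still dominate only u₃, v₃ and v₂, whose statuses do not involve u₀ and u₁.
windowSurplus : (v₀ v₁ u₂ v₂ u₃ v₃ : Bool) → ℕ
windowSurplus v₀ v₁ u₂ v₂ u₃ v₃ =
  surplus (status u₃ u₂ v₃) (status v₃ u₃ v₁) (status v₂ u₂ v₀)

∀-bool? : {P : Bool → Set} → (∀ b → Dec (P b)) → Dec (∀ b → P b)
∀-bool? P? =
  map′ (λ { (t , f) true → t ; (t , f) false → f }) (λ p → p true , p false) (P? true ×-dec P? false)

-- Checked on all 256 assignments. Once column 4 has entered, no later column can dominate `u₃` or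
-- `v₂`, so the hypotheses require these two to be dominated by now; the other statuses are carried
-- to the next window.
windowSurplus-step : ∀ v₀ v₁ u₂ v₂ u₃ v₃ u₄ v₄ →
  T (u₃ ∨ u₂ ∨ u₄ ∨ v₃) → T (v₂ ∨ v₀ ∨ v₄ ∨ u₂) →
  3 + windowSurplus v₁ v₂ u₃ v₃ u₄ v₄
    ≤ 5 * (bit u₄ + bit v₄) + windowSurplus v₀ v₁ u₂ v₂ u₃ v₃
windowSurplus-step = toWitness {a? =
  ∀-bool? λ v₀ → ∀-bool? λ v₁ → ∀-bool? λ u₂ → ∀-bool? λ v₂ →
  ∀-bool? λ u₃ → ∀-bool? λ v₃ → ∀-bool? λ u₄ → ∀-bool? λ v₄ →
  T? _ →-dec (T? _ →-dec (_ ≤? _))} _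

-- The amortised sum: consecutive values of the potential `g` cancel. The induction peels off the
-- first step, so `f` and `g` are shifted together.
telescope : ∀ a c (f g : ℕ → ℕ) → (∀ n → a + g (suc n) ≤ c * f n + g n) →
            ∀ n → n * a + g n ≤ c * sum (applyUpTo f n) + g 0
telescope a c f g step zero    = m≤n+m (g 0) (c * 0)
telescope a c f g step (suc n) = begin
  a + n * a + g (suc n)                        ≡⟨ +-assoc a (n * a) (g (suc n)) ⟩
  a + (n * a + g (suc n))                      ≤⟨ +-monoʳ-≤ a (telescope a c (f ∘ suc) (g ∘ suc) (step ∘ suc) n) ⟩
  a + (c * s + g 1)                            ≡⟨ swap a (c * s) (g 1) ⟩
  a + g 1 + c * s                              ≤⟨ +-monoˡ-≤ (c * s) (step 0) ⟩
  c * f 0 + g 0 + c * s                        ≡⟨ factor c (f 0) (g 0) s ⟩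
  c * (f 0 + s) + g 0                          ∎
  where
  open ≤-Reasoning
  s : ℕ
  s = sum (applyUpTo (f ∘ suc) n)
  swap : ∀ x y z → x + (y + z) ≡ x + z + y
  swap = solve-∀
  factor : ∀ c x y s → c * x + y + c * s ≡ c * (x + s) + y
  factor = solve-∀

-- Regroups the count of both rows by columns. Letting `f` and `g` be any functions that agree with
-- the two vectors allows the induction to shift them.
∣++∣≡sum : ∀ {n} (p q : Subset n) (f g : ℕ → Bool) →
  (∀ i → f (toℕ i) ≡ lookup p i) → (∀ i → g (toℕ i) ≡ lookup q i) →
  ∣ p ∣ + ∣ q ∣ ≡ sum (applyUpTo (λ i → bit (f i) + bit (g i)) n)
∣++∣≡sum []      []      f g f≡p g≡q = refl
∣++∣≡sum (b ∷ p) (c ∷ q) f g f≡p g≡q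
  rewrite f≡p zero | g≡q zero
        | sym (∣++∣≡sum p q (f ∘ suc) (g ∘ suc) (f≡p ∘ suc) (g≡q ∘ suc)) = cons b c
  where
  cons : ∀ b c → ∣ b ∷ p ∣ + ∣ c ∷ q ∣ ≡ bit b + bit c + (∣ p ∣ + ∣ q ∣)
  cons true  true  = cong suc (+-suc ∣ p ∣ ∣ q ∣)
  cons true  false = refl
  cons false true  = +-suc ∣ p ∣ ∣ q ∣
  cons false false = refl

∣p++q∣≡∣p∣+∣q∣ : ∀ {m n} (p : Subset m) (q : Subset n) → ∣ p ++ q ∣ ≡ ∣ p ∣ + ∣ q ∣
∣p++q∣≡∣p∣+∣q∣ []            q = refl
∣p++q∣≡∣p∣+∣q∣ (inside  ∷ p) q = cong suc (∣p++q∣≡∣p∣+∣q∣ p q)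
∣p++q∣≡∣p∣+∣q∣ (outside ∷ p) q = ∣p++q∣≡∣p∣+∣q∣ p q

module _ {k : ℕ} .{{_ : NonZero k}} (1≤k : 1 ≤ k) (2≤k : 2 ≤ k) (S : Cell k → Bool)
  (dominating : ∀ x → ¬ S x ≡ true → ∃ λ y → S y ≡ true × SymClosure Arc x y)
  where

  private
    -- The two rows unrolled to periodic sequences on ℕ, so that sliding the window needs no case
    -- for wrapping around.
    U V : ℕ → Bool
    U n = S (u (n mod k))
    V n = S (v (n mod k))

    T-∨₁ : ∀ b {c} → b ≡ true → T (b ∨ c)
    T-∨₁ true _ = _

    T-∨₂ : ∀ b {c} → T c → T (b ∨ c)
    T-∨₂ true  _ = _
    T-∨₂ false p = p

    pred-column : ∀ {m} → m ≤ k → ∀ n {i : Fin k} → (m + n) mod k ≡ i ⊕ m → i ≡ n mod k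
    pred-column {m} m≤k n eq = sym (⊕-cancelʳ m≤k (trans (mod-⊕ n m) (trans (cong (_mod k) (+-comm n m)) eq)))

    succ-column : ∀ m n {i : Fin k} → i ≡ (n mod k) ⊕ m → i ≡ (m + n) mod k
    succ-column m n eq = trans eq (trans (mod-⊕ n m) (cong (_mod k) (+-comm n m)))

  -- An unchosen vertex is dominated along one of its three arcs, and each arc yields one disjunct.
  -- The disjuncts are ordered as in `windowSurplus-step`.
  outer-dominated : ∀ n → T (U (1 + n) ∨ U n ∨ U (2 + n) ∨ V (1 + n))
  outer-dominated n with U (1 + n) in eq
  ... | true  = _
  ... | false with dominating (u ((1 + n) mod k)) (λ p → contradiction (trans (sym eq) p) λ ())
  ...   | u j , j∈S , fwd (outer p) =
      T-∨₂ (U n) (T-∨₁ (U (2 + n)) (trans (cong (S ∘ inj₁) (sym (succ-column 1 (1 + n) p))) j∈S))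
  ...   | u j , j∈S , bwd (outer p) =
      T-∨₁ (U n) (trans (cong (S ∘ inj₁) (sym (pred-column 1≤k n p))) j∈S)
  ...   | v j , j∈S , fwd (spoke refl) =
      T-∨₂ (U n) (T-∨₂ (U (2 + n)) (subst T (sym j∈S) _))

  inner-dominated : ∀ n → T (V (2 + n) ∨ V n ∨ V (4 + n) ∨ U (2 + n))
  inner-dominated n with V (2 + n) in eq
  ... | true  = _
  ... | false with dominating (v ((2 + n) mod k)) (λ p → contradiction (trans (sym eq) p) λ ())
  ...   | v j , j∈S , fwd (inner p) =
      T-∨₂ (V n) (T-∨₁ (V (4 + n)) (trans (cong (S ∘ inj₂) (sym (succ-column 2 (2 + n) p))) j∈S))
  ...   | v j , j∈S , bwd (inner p) =
      T-∨₁ (V n) (trans (cong (S ∘ inj₂) (sym (pred-column 2≤k n p))) j∈S)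
  ...   | u j , j∈S , bwd (spoke refl) =
      T-∨₂ (V n) (T-∨₂ (V (4 + n)) (subst T (sym j∈S) _))

  private
    window : ℕ → ℕ
    window n = windowSurplus (V n) (V (1 + n)) (U (2 + n)) (V (2 + n)) (U (3 + n)) (V (3 + n))

    window-step : ∀ n → 3 + window (suc n) ≤ 5 * (bit (U (4 + n)) + bit (V (4 + n))) + window n
    window-step n = windowSurplus-step
      (V n) (V (1 + n)) (U (2 + n)) (V (2 + n)) (U (3 + n)) (V (3 + n)) (U (4 + n)) (V (4 + n))
      (outer-dominated (2 + n)) (inner-dominated n)

    column-period : ∀ j n → (j + (k + n)) mod k ≡ (j + n) mod k
    column-period j n = trans (cong (_mod k) (rearrange j k n)) (mod-period (j + n) 1)
      where
      rearrange : ∀ j k n → j + (k + n) ≡ j + n + 1 * k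
      rearrange = solve-∀

    window-period : ∀ n → window (k + n) ≡ window n
    window-period n
      rewrite column-period 0 n | column-period 1 n | column-period 2 n | column-period 3 n = refl

  dominating-sum : k * 3 ≤ 5 * sum (applyUpTo (λ n → bit (U n) + bit (V n)) k)
  -- After `k` steps the potential is `window (k + c)`, which equals the initial `window c` by
  -- periodicity, so it cancels.
  dominating-sum = +-cancelʳ-≤ (window c) _ _
    (subst (λ w → k * 3 + w ≤ 5 * sum (applyUpTo f k) + window c) (window-period c) (telescope 3 5 f g step k))
    where
    -- Chosen so that the column entering the window that starts at n + c is column n.
    c : ℕ
    c = 4 * (k ∸ 1)

    f g : ℕ → ℕ
    f n = bit (U n) + bit (V n)
    g n = window (n + c)

    entering : ∀ n → (4 + (n + c)) mod k ≡ n mod k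
    entering n = trans (cong (_mod k) (begin
      4 + (n + c)              ≡⟨ rearrange n (k ∸ 1) ⟩
      n + 4 * (1 + (k ∸ 1))    ≡⟨ cong (λ m → n + 4 * m) (m+[n∸m]≡n 1≤k) ⟩
      n + 4 * k                ∎)) (mod-period n 4)
      where
      open ≡-Reasoning
      rearrange : ∀ n m → 4 + (n + 4 * m) ≡ n + 4 * (1 + m)
      rearrange = solve-∀

    step : ∀ n → 3 + g (suc n) ≤ 5 * f n + g n
    step n = subst (λ i → 3 + g (suc n) ≤ 5 * (bit (S (u i)) + bit (S (v i))) + g n)
      (entering n) (window-step (n + c))

-- Edge domination number, lower bound

-- Names each edge in the single orientation of `Arc`, by its kind and the index of its first end.
-- This gives 3k names, whereas `Edge` has both orientations.
Name : ℕ → Set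
Name k = Fin 3 × Fin k

pattern outerEdge i = 0F , i
pattern spokeEdge i = 1F , i
pattern innerEdge i = 2F , i

-- Equal positions in `xs` hold equal elements, so sending `i` to the position of `f i` is
-- injective. Repetitions in `xs` do no harm.
injection-into-list⇒≤ : ∀ {A : Set} {n} {f : Fin n → A} → Injective _≡_ _≡_ f →
                        ∀ xs → (∀ i → f i ∈ˡ xs) → n ≤ length xs
injection-into-list⇒≤ {A} inj xs f∈xs =
  injective⇒≤ {f = index ∘ f∈xs} (λ {i} {j} eq → inj (index-injective (setoid A) (f∈xs i) (f∈xs j) eq))

length-concatMap : ∀ {A B : Set} (f : A → List B) c → (∀ x → length (f x) ≡ c) →
                   ∀ xs → length (concatMap f xs) ≡ length xs * c
length-concatMap f c eq []       = refl
length-concatMap f c eq (x ∷ xs) =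
  trans (length-++ (f x)) (cong₂ _+_ (eq x) (length-concatMap f c eq xs))

module _ {k : ℕ} .{{_ : NonZero k}} (1≤k : 1 ≤ k) (2≤k : 2 ≤ k) where

  end₁ end₂ : Name k → Cell k
  end₁ (outerEdge i) = u i
  end₁ (spokeEdge i) = u i
  end₁ (innerEdge i) = v i
  end₂ (outerEdge i) = u (i ⊕ 1)
  end₂ (spokeEdge i) = v i
  end₂ (innerEdge i) = v (i ⊕ 2)

  name-arc : ∀ n → Arc (end₁ n) (end₂ n)
  name-arc (outerEdge i) = outer refl
  name-arc (spokeEdge i) = spoke refl
  name-arc (innerEdge i) = inner refl

  -- The order is spoke, outgoing edge, incoming edge.
  star : Cell k → List (Name k)
  star (u i) = spokeEdge i ∷ outerEdge i ∷ outerEdge (i ⊖ 1) ∷ []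
  star (v i) = spokeEdge i ∷ innerEdge i ∷ innerEdge (i ⊖ 2) ∷ []

  ∈-star : ∀ {x} n → x ≡ end₁ n ⊎ x ≡ end₂ n → n ∈ˡ star x
  ∈-star (outerEdge i) (inj₁ refl) = there (here refl)
  ∈-star (outerEdge i) (inj₂ refl) = there (there (here (cong (0F ,_) (sym (⊕-⊖ i 1≤k)))))
  ∈-star (spokeEdge i) (inj₁ refl) = here refl
  ∈-star (spokeEdge i) (inj₂ refl) = here refl
  ∈-star (innerEdge i) (inj₁ refl) = there (here refl)
  ∈-star (innerEdge i) (inj₂ refl) = there (there (here (cong (2F ,_) (sym (⊕-⊖ i 2≤k)))))

  -- The star of one end, followed by the star of the other without the arc itself, which the first
  -- star already lists. This omission makes the length 5 instead of 6.
  touching : ∀ {x y : Cell k} → Arc x y → List (Name k)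
  touching (outer {i} {j} _) = star (u i) List.++ spokeEdge j ∷ outerEdge j ∷ []
  touching (spoke {i} {j} _) = star (u i) List.++ innerEdge j ∷ innerEdge (j ⊖ 2) ∷ []
  touching (inner {i} {j} _) = star (v i) List.++ spokeEdge j ∷ innerEdge j ∷ []

  length-touching : ∀ {x y} (a : Arc x y) → length (touching a) ≡ 5
  length-touching (outer _) = refl
  length-touching (spoke _) = refl
  length-touching (inner _) = refl

  star⊆touching₁ : ∀ {x y n} (a : Arc x y) → n ∈ˡ star x → n ∈ˡ touching a
  star⊆touching₁ (outer _) = ∈-++⁺ˡ
  star⊆touching₁ (spoke _) = ∈-++⁺ˡ
  star⊆touching₁ (inner _) = ∈-++⁺ˡ

  star⊆touching₂ : ∀ {x y n} (a : Arc x y) → n ∈ˡ star y → n ∈ˡ touching a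
  star⊆touching₂ (outer {i} refl) (here p)                 = there (there (there (here p)))
  star⊆touching₂ (outer {i} refl) (there (here p))         = there (there (there (there (here p))))
  -- The incoming edge at `i ⊕ 1` is the arc itself, found as the outgoing edge in the star of
  -- `u i`.
  star⊆touching₂ (outer {i} refl) (there (there (here p))) =
    there (here (trans p (cong (0F ,_) (⊕-⊖ i 1≤k))))
  star⊆touching₂ (spoke refl)     (here p)                 = here p
  star⊆touching₂ (spoke refl)     (there p)                = there (there (there p))
  star⊆touching₂ (inner {i} refl) (here p)                 = there (there (there (here p)))
  star⊆touching₂ (inner {i} refl) (there (here p))         = there (there (there (there (here p))))
  star⊆touching₂ (inner {i} refl) (there (there (here p))) =
    there (here (trans p (cong (2F ,_) (⊕-⊖ i 2≤k))))

  touching′ : ∀ {x y : Cell k} → SymClosure Arc x y → List (Name k)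
  touching′ (fwd a) = touching a
  touching′ (bwd a) = touching a

  length-touching′ : ∀ {x y} (a : SymClosure Arc x y) → length (touching′ a) ≡ 5
  length-touching′ (fwd a) = length-touching a
  length-touching′ (bwd a) = length-touching a

  star⊆touching′ : ∀ {x y z n} (a : SymClosure Arc x y) → z ≡ x ⊎ z ≡ y → n ∈ˡ star z → n ∈ˡ touching′ a
  star⊆touching′ (fwd a) (inj₁ refl) = star⊆touching₁ a
  star⊆touching′ (fwd a) (inj₂ refl) = star⊆touching₂ a
  star⊆touching′ (bwd a) (inj₁ refl) = star⊆touching₂ a
  star⊆touching′ (bwd a) (inj₂ refl) = star⊆touching₁ a

module _ {G : Graph} where

  isEndOf? : ∀ x (e : Edge G) → Dec (x isEndOf e)
  isEndOf? x e = (x ≟ᶠ Edge.src e) ⊎-dec (x ≟ᶠ Edge.tgt e)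

  common? : ∀ (e f : Edge G) x → Dec (x isEndOf e × x isEndOf f)
  common? e f x = isEndOf? x e ×-dec isEndOf? x f

  disjoint? : ∀ (e f : Edge G) → Dec (Disjoint e f)
  disjoint? e f = allᶠ? (¬? ∘ common? e f)

  -- If `e` were disjoint from every edge of `M`, it could be added. Disjointness is decidable on
  -- finitely many vertices, so its failure yields an actual common end.
  maximal⇒touched : ∀ {M} → IsMaximalMatching G M → ∀ e →
                    ∃ λ f → f ∈ˡ M × ∃ λ x → x isEndOf e × x isEndOf f
  maximal⇒touched {M} (matching , maximal) e
    with f , f∈M , ¬disj ← find (¬All⇒Any¬ (disjoint? e) M (λ disj → maximal e (disj ∷ matching)))
    with x , ¬¬p ← ¬∀⟶∃¬ _ _ (¬? ∘ common? e f) ¬disj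
    = f , f∈M , x , decidable-stable (common? e f x) ¬¬p

  touched⇒maximal : ∀ {M} → (∀ e → ∃ λ f → f ∈ˡ M × ∃ λ x → x isEndOf e × x isEndOf f) →
                    ∀ e → ¬ IsMatching G (e ∷ M)
  touched⇒maximal touched e (disj ∷ _) with f , f∈M , x , p ← touched e = All.lookup disj f∈M x p

-- Both lower bounds, stated for `GP₂`

module _ (k : ℕ) (5≤k : 5 ≤ k) where

  private
    instance
      k≢0 : NonZero k
      k≢0 = >-nonZero (≤-trans (s≤s z≤n) 5≤k)

    1≤k : 1 ≤ k
    1≤k = ≤-trans (s≤s z≤n) 5≤k

    2≤k : 2 ≤ k
    2≤k = ≤-trans (s≤s (s≤s z≤n)) 5≤k

    G : Graph
    G = GP₂ k 5≤k

  dominating⇒≤ : ∀ S → IsDominating G S → 3 * k ≤ ∣ S ∣ * 5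
  dominating⇒≤ S dom with Vec.splitAt k S
  ... | p , q , refl = begin
    3 * k                  ≡⟨ *-comm 3 k ⟩
    k * 3                  ≤⟨ dominating-sum 1≤k 2≤k member dominating ⟩
    5 * total              ≡⟨ *-comm 5 total ⟩
    total * 5              ≡⟨ cong (_* 5) (∣++∣≡sum p q U V U≡p V≡q) ⟨
    (∣ p ∣ + ∣ q ∣) * 5    ≡⟨ cong (_* 5) (∣p++q∣≡∣p∣+∣q∣ p q) ⟨
    ∣ p ++ q ∣ * 5         ∎
    where
    open ≤-Reasoning
    member : Cell k → Bool
    member = [ lookup p , lookup q ]′
    U V : ℕ → Bool
    U n = member (u (n mod k))
    V n = member (v (n mod k))
    total : ℕ
    total = sum (applyUpTo (λ n → bit (U n) + bit (V n)) k)
    U≡p : ∀ i → U (toℕ i) ≡ lookup p i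
    U≡p i = cong (lookup p) (toℕ-mod-inverse i)
    V≡q : ∀ i → V (toℕ i) ≡ lookup q i
    V≡q i = cong (lookup q) (toℕ-mod-inverse i)
    lookup-join : ∀ x → lookup (p ++ q) (join k k x) ≡ member x
    lookup-join x = trans (lookup-splitAt k p q (join k k x)) (cong member (splitAt-join k k x))
    dominating : ∀ x → ¬ member x ≡ true → ∃ λ y → member y ≡ true × SymClosure Arc x y
    dominating x x∉S
      with y , y∈S , adj ← dom (join k k x) (λ x∈S → x∉S (trans (sym (lookup-join x)) ([]=⇒lookup x∈S)))
      = splitAt k y , trans (sym (lookup-splitAt k p q y)) ([]=⇒lookup y∈S)
      , subst (λ z → SymClosure Arc z (splitAt k y)) (splitAt-join k k x) adj

  -- Each of the 3k names, enumerated by `remQuot`, occurs in the list of some edge of `M`, and each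
  -- edge contributes a list of length 5.
  maximalMatching⇒≤ : ∀ M → IsMaximalMatching G M → 3 * k ≤ length M * 5
  maximalMatching⇒≤ M max = begin
    3 * k                        ≤⟨ injection-into-list⇒≤ remQuot-injective (concatMap touch M) (∈-touch ∘ remQuot k) ⟩
    length (concatMap touch M)   ≡⟨ length-concatMap touch 5 (length-touching′ 1≤k 2≤k ∘ Edge.joined) M ⟩
    length M * 5                 ∎
    where
    open ≤-Reasoning
    touch : Edge G → List (Name k)
    touch e = touching′ 1≤k 2≤k (Edge.joined e)
    remQuot-injective : Injective _≡_ _≡_ (remQuot {3} k)
    remQuot-injective {x} {y} eq =
      trans (sym (combine-remQuot k x)) (trans (cong (uncurry combine) eq) (combine-remQuot k y))
    splitEnd : ∀ {z} {x y : Cell k} → z ≡ join k k x ⊎ z ≡ join k k y → splitAt k z ≡ x ⊎ splitAt k z ≡ y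
    splitEnd = Sum.map (λ p → trans (cong (splitAt k) p) (splitAt-join k k _))
                       (λ p → trans (cong (splitAt k) p) (splitAt-join k k _))
    ∈-touch : ∀ n → n ∈ˡ concatMap touch M
    ∈-touch n
      with f , f∈M , x , x∈e , x∈f ← maximal⇒touched max (edge (join-adj⁺ (fwd (name-arc 1≤k 2≤k n))))
      = ∈-concatMap⁺ touch (Any.map (λ { refl →
          star⊆touching′ 1≤k 2≤k (Edge.joined f) (Sum.map (cong (splitAt k)) (cong (splitAt k)) x∈f)
            (∈-star 1≤k 2≤k n (splitEnd x∈e)) }) f∈M)

-- Lifting from the Petersen graph GP(5,2)

petersenSet : Cell 5 → Bool
petersenSet (u 0F) = true
petersenSet (v 2F) = true
petersenSet (v 3F) = true
petersenSet _      = false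

petersenSet-dominating : ∀ x → petersenSet x ≡ true ⊎ ∃ λ y → petersenSet y ≡ true × SymClosure Arc x y
petersenSet-dominating (u 0F) = inj₁ refl
petersenSet-dominating (u 1F) = inj₂ (u 0F , refl , bwd (outer refl))
petersenSet-dominating (u 2F) = inj₂ (v 2F , refl , fwd (spoke refl))
petersenSet-dominating (u 3F) = inj₂ (v 3F , refl , fwd (spoke refl))
petersenSet-dominating (u 4F) = inj₂ (u 0F , refl , fwd (outer refl))
petersenSet-dominating (v 0F) = inj₂ (v 2F , refl , fwd (inner refl))
petersenSet-dominating (v 1F) = inj₂ (v 3F , refl , fwd (inner refl))
petersenSet-dominating (v 2F) = inj₁ refl
petersenSet-dominating (v 3F) = inj₁ refl
petersenSet-dominating (v 4F) = inj₂ (v 2F , refl , bwd (inner refl))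

-- The three matching edges, oriented as arcs. None of them wraps around modulo 5, so each lift
-- stays within one block of five columns.
tail head : Fin 3 → Cell 5
tail 0F = u 3F
tail 1F = u 1F
tail 2F = v 0F
head 0F = u 4F
head 1F = v 1F
head 2F = v 2F

-- Sends both ends of a matching edge to its index; the values at the unmatched `u 0F`, `u 2F`,
-- `v 3F` and `v 4F` are arbitrary.
part : Cell 5 → Fin 3
part (u 3F) = 0F
part (u 4F) = 0F
part (u _)  = 1F
part (v 1F) = 1F
part (v _)  = 2F

part-tail : ∀ a → part (tail a) ≡ a
part-tail 0F = refl
part-tail 1F = refl
part-tail 2F = refl

part-head : ∀ a → part (head a) ≡ a
part-head 0F = refl
part-head 1F = refl
part-head 2F = refl

Matched : Cell 5 → Set
Matched x = ∃ λ a → x ≡ tail a ⊎ x ≡ head a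

matched? : ∀ x → Dec (Matched x)
matched? x = anyᶠ? λ a → ≡-dec _≟ᶠ_ _≟ᶠ_ x (tail a) ⊎-dec ≡-dec _≟ᶠ_ _≟ᶠ_ x (head a)

-- The four unmatched vertices are independent, which is the maximality of the matching in the
-- Petersen graph.
arc-matched : ∀ {x y} → Arc {5} x y → Matched x ⊎ Matched y
arc-matched (outer {i} refl) = toWitness {a? = allᶠ? λ i → matched? (u i) ⊎-dec matched? (u (i ⊕ 1))} _ i
arc-matched (spoke {i} refl) = toWitness {a? = allᶠ? λ i → matched? (u i) ⊎-dec matched? (v i)} _ i
arc-matched (inner {i} refl) = toWitness {a? = allᶠ? λ i → matched? (v i) ⊎-dec matched? (v (i ⊕ 2))} _ i

-- The first five entries compute to `Vec.tabulate f`, and the rest is the same vector for one block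
-- fewer.
∣tabulate-remainder∣ : ∀ q (f : Fin 5 → Bool) →
  ∣ Vec.tabulate (f ∘ remainder {q} 5) ∣ ≡ q * ∣ Vec.tabulate f ∣
∣tabulate-remainder∣ zero    f = refl
∣tabulate-remainder∣ (suc q) f =
  trans (∣p++q∣≡∣p∣+∣q∣ (Vec.tabulate f) (Vec.tabulate (f ∘ remainder {q} 5)))
        (cong (∣ Vec.tabulate f ∣ +_) (∣tabulate-remainder∣ q f))

module _ (q : ℕ) (5≤k : 5 ≤ q * 5) where

  private
    k : ℕ
    k = q * 5

    instance
      k≢0 : NonZero k
      k≢0 = >-nonZero (≤-trans (s≤s z≤n) 5≤k)

    G : Graph
    G = GP₂ k 5≤k

    residue : Fin k → Fin 5
    residue = remainder {q} 5

    block : Fin k → Fin q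
    block = quotient {q} 5

  residue-mod : ∀ i → residue i ≡ toℕ i mod 5
  residue-mod i = toℕ-injective (begin
    toℕ (residue i)                               ≡⟨ m<n⇒m%n≡m (toℕ<n (residue i)) ⟨
    toℕ (residue i) % 5                           ≡⟨ [m+kn]%n≡m%n (toℕ (residue i)) (toℕ (block i)) 5 ⟨
    (toℕ (residue i) + toℕ (block i) * 5) % 5     ≡⟨ cong (_% 5) (rearrange (toℕ (residue i)) (toℕ (block i))) ⟩
    (5 * toℕ (block i) + toℕ (residue i)) % 5     ≡⟨ cong (_% 5) (toℕ-combine (block i) (residue i)) ⟨
    toℕ (combine (block i) (residue i)) % 5       ≡⟨ cong (λ j → toℕ j % 5) (combine-remQuot {q} 5 i) ⟩
    toℕ i % 5                                     ≡⟨ toℕ-mod (toℕ i) ⟨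
    toℕ (toℕ i mod 5)                             ∎)
    where
    open ≡-Reasoning
    rearrange : ∀ r b → r + b * 5 ≡ 5 * b + r
    rearrange = solve-∀

  -- Since 5 divides `k`, reduction modulo `k` does not affect the residue modulo 5.
  residue-⊕ : ∀ (i : Fin k) m → residue (i ⊕ m) ≡ residue i ⊕ m
  residue-⊕ i m = begin
    residue (i ⊕ m)             ≡⟨ residue-mod (i ⊕ m) ⟩
    toℕ (i ⊕ m) mod 5           ≡⟨ %⇒mod {m = toℕ (i ⊕ m)} {toℕ i + m} mod-5 ⟩
    (toℕ i + m) mod 5           ≡⟨ mod-⊕ (toℕ i) m ⟨
    (toℕ i mod 5) ⊕ m           ≡⟨ cong (_⊕ m) (residue-mod i) ⟨
    residue i ⊕ m               ∎
    where
    open ≡-Reasoning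
    mod-5 : toℕ (i ⊕ m) % 5 ≡ (toℕ i + m) % 5
    mod-5 = trans (cong (_% 5) (toℕ-mod (toℕ i + m)))
                  (m∣n⇒o%n%m≡o%m 5 k (toℕ i + m) (divides-refl q))

  -- The hypothesis is an equation in ℕ: the shift does not leave the block.
  combine-⊕ : ∀ (b : Fin q) {r r′ : Fin 5} {m} → toℕ r + m ≡ toℕ r′ → combine b r′ ≡ combine b r ⊕ m
  combine-⊕ b {r} {r′} {m} eq = toℕ-injective (begin
    toℕ (combine b r′)                 ≡⟨ m<n⇒m%n≡m (toℕ<n (combine b r′)) ⟨
    toℕ (combine b r′) % k             ≡⟨ cong (_% k) (toℕ-combine b r′) ⟩
    (5 * toℕ b + toℕ r′) % k           ≡⟨ cong (λ s → (5 * toℕ b + s) % k) eq ⟨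
    (5 * toℕ b + (toℕ r + m)) % k      ≡⟨ cong (_% k) (+-assoc (5 * toℕ b) (toℕ r) m) ⟨
    (5 * toℕ b + toℕ r + m) % k        ≡⟨ cong (λ s → (s + m) % k) (toℕ-combine b r) ⟨
    (toℕ (combine b r) + m) % k        ≡⟨ toℕ-mod (toℕ (combine b r) + m) ⟨
    toℕ (combine b r ⊕ m)              ∎)
    where open ≡-Reasoning

  cover : Cell k → Cell 5
  cover = Sum.map residue residue

  lift : Fin q → Cell 5 → Cell k
  lift b = Sum.map (combine b) (combine b)

  blockOf : Cell k → Fin q
  blockOf = [ block , block ]′

  cover-lift : ∀ b y → cover (lift b y) ≡ y
  cover-lift b (u r) = cong (inj₁ ∘ proj₂) (remQuot-combine b r)
  cover-lift b (v r) = cong (inj₂ ∘ proj₂) (remQuot-combine b r)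

  blockOf-lift : ∀ b y → blockOf (lift b y) ≡ b
  blockOf-lift b (u r) = cong proj₁ (remQuot-combine b r)
  blockOf-lift b (v r) = cong proj₁ (remQuot-combine b r)

  lift-cover : ∀ x → lift (blockOf x) (cover x) ≡ x
  lift-cover (u i) = cong inj₁ (combine-remQuot {q} 5 i)
  lift-cover (v i) = cong inj₂ (combine-remQuot {q} 5 i)

  cover-arc : ∀ {x y} → Arc {k} x y → Arc {5} (cover x) (cover y)
  cover-arc (outer {i} refl) = outer (residue-⊕ i 1)
  cover-arc (spoke refl)     = spoke refl
  cover-arc (inner {i} refl) = inner (residue-⊕ i 2)

  residue-⊖ : ∀ {m} → m ≤ 5 → ∀ (i : Fin k) {r} → residue i ≡ r ⊕ m → residue (i ⊖ m) ≡ r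
  residue-⊖ {m} m≤5 i eq = ⊕-cancelʳ m≤5
    (trans (sym (residue-⊕ (i ⊖ m) m)) (trans (cong residue (⊖-⊕ i (≤-trans m≤5 5≤k))) eq))

  -- The lifting property of the covering map, which carries domination from the Petersen graph up
  -- to `GP₂ k`. Arcs taken backwards lift through `⊖`.
  lift-adj : ∀ x {y} → SymClosure (Arc {5}) (cover x) y → ∃ λ x′ → SymClosure (Arc {k}) x x′ × cover x′ ≡ y
  lift-adj (u i) (fwd (outer refl)) = u (i ⊕ 1) , fwd (outer refl) , cong inj₁ (residue-⊕ i 1)
  lift-adj (u i) (fwd (spoke refl)) = v i , fwd (spoke refl) , refl
  lift-adj (u i) (bwd (outer eq))   =
    u (i ⊖ 1) , bwd (outer (sym (⊖-⊕ i (≤-trans (m≤m+n 1 4) 5≤k)))) , cong inj₁ (residue-⊖ (m≤m+n 1 4) i eq)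
  lift-adj (v i) (fwd (inner refl)) = v (i ⊕ 2) , fwd (inner refl) , cong inj₂ (residue-⊕ i 2)
  lift-adj (v i) (bwd (spoke refl)) = u i , bwd (spoke refl) , refl
  lift-adj (v i) (bwd (inner eq))   =
    v (i ⊖ 2) , bwd (inner (sym (⊖-⊕ i (≤-trans (m≤m+n 2 3) 5≤k)))) , cong inj₂ (residue-⊖ (m≤m+n 2 3) i eq)

  outerPart innerPart : Subset k
  outerPart = Vec.tabulate (petersenSet ∘ inj₁ ∘ residue)
  innerPart = Vec.tabulate (petersenSet ∘ inj₂ ∘ residue)

  dominatingSet : Subset (k + k)
  dominatingSet = outerPart ++ innerPart

  lookup-dominatingSet : ∀ x → lookup dominatingSet x ≡ petersenSet (cover (splitAt k x))
  lookup-dominatingSet x with splitAt k x | lookup-splitAt k outerPart innerPart x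
  ... | u i | eq = trans eq (lookup∘tabulate (petersenSet ∘ inj₁ ∘ residue) i)
  ... | v i | eq = trans eq (lookup∘tabulate (petersenSet ∘ inj₂ ∘ residue) i)

  dominatingSet-dominating : IsDominating G dominatingSet
  dominatingSet-dominating x x∉S with petersenSet-dominating (cover (splitAt k x))
  ... | inj₁ p = contradiction (lookup⇒[]= x dominatingSet (trans (lookup-dominatingSet x) p)) x∉S
  ... | inj₂ (y , y∈D , adj) with x′ , adj′ , eq ← lift-adj (splitAt k x) adj
      = join k k x′
      , lookup⇒[]= _ _ (trans (lookup-dominatingSet (join k k x′))
                         (trans (cong (petersenSet ∘ cover) (splitAt-join k k x′))
                           (trans (cong petersenSet eq) y∈D)))
      , subst (SymClosure Arc (splitAt k x)) (sym (splitAt-join k k x′)) adj′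

  ∣dominatingSet∣ : ∣ dominatingSet ∣ ≡ q * 3
  ∣dominatingSet∣ = begin
    ∣ dominatingSet ∣                ≡⟨ ∣p++q∣≡∣p∣+∣q∣ outerPart innerPart ⟩
    ∣ outerPart ∣ + ∣ innerPart ∣    ≡⟨ cong₂ _+_ (∣tabulate-remainder∣ q (petersenSet ∘ inj₁))
                                                  (∣tabulate-remainder∣ q (petersenSet ∘ inj₂)) ⟩
    -- Each block has one chosen outer vertex and two chosen inner vertices.
    q * 1 + q * 2                    ≡⟨ *-distribˡ-+ q 1 2 ⟨
    q * 3                            ∎
    where open ≡-Reasoning

  matchingArc : ∀ b a → Arc {k} (lift b (tail a)) (lift b (head a))
  matchingArc b 0F = outer (combine-⊕ b refl)
  matchingArc b 1F = spoke refl
  matchingArc b 2F = inner (combine-⊕ b refl)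

  matchingEdge : Fin q × Fin 3 → Edge G
  matchingEdge (b , a) = edge (join-adj⁺ (fwd (matchingArc b a)))

  matching : List (Edge G)
  matching = tabulate (matchingEdge ∘ remQuot {q} 3)

  -- Recovers from an end of a lifted matching edge the position of that edge in `matching`. Two
  -- edges with a common end therefore have the same position, which proves the matching property.
  owner : Fin (k + k) → Fin (q * 3)
  owner x = combine (blockOf (splitAt k x)) (part (cover (splitAt k x)))

  owner-lift : ∀ b y → owner (join k k (lift b y)) ≡ combine b (part y)
  owner-lift b y = trans
    (cong (λ z → combine (blockOf z) (part (cover z))) (splitAt-join k k (lift b y)))
    (cong₂ (λ c z → combine c (part z)) (blockOf-lift b y) (cover-lift b y))

  owner-end : ∀ {x} t → x isEndOf matchingEdge (remQuot {q} 3 t) → owner x ≡ t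
  owner-end t = λ
    { (inj₁ refl) → trans (owner-lift b (tail a))
        (trans (cong (combine b) (part-tail a)) (combine-remQuot {q} 3 t))
    ; (inj₂ refl) → trans (owner-lift b (head a))
        (trans (cong (combine b) (part-head a)) (combine-remQuot {q} 3 t))
    }
    where
    b : Fin q
    b = quotient {q} 3 t
    a : Fin 3
    a = remainder {q} 3 t

  matching-isMatching : IsMatching G matching
  matching-isMatching = tabulate⁺ λ {s} {t} s≢t x (x∈s , x∈t) →
    s≢t (trans (sym (owner-end s x∈s)) (owner-end t x∈t))

  -- A vertex is the lift of its image into its own block, so the lift of the matching edge to that
  -- block has it as an end.
  matched-touched : ∀ x → Matched (cover (splitAt k x)) → ∃ λ f → f ∈ˡ matching × x isEndOf f
  matched-touched x (a , end) = matchingEdge (b , a) , f∈M , Sum.map isEnd isEnd end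
    where
    b : Fin q
    b = blockOf (splitAt k x)
    f∈M : matchingEdge (b , a) ∈ˡ matching
    f∈M = subst (λ p → matchingEdge p ∈ˡ matching) (remQuot-combine b a) (∈-tabulate⁺ (combine b a))
    isEnd : ∀ {y} → cover (splitAt k x) ≡ y → x ≡ join k k (lift b y)
    isEnd refl = trans (sym (join-splitAt k k x)) (cong (join k k) (sym (lift-cover (splitAt k x))))

  matching-isMaximal : IsMaximalMatching G matching
  matching-isMaximal = matching-isMatching , touched⇒maximal touched
    where
    matchedEnd : ∀ {x y} → SymClosure (Arc {k}) x y → Matched (cover x) ⊎ Matched (cover y)
    matchedEnd (fwd a) = arc-matched (cover-arc a)
    matchedEnd (bwd a) = Sum.swap (arc-matched (cover-arc a))
    touched : ∀ e → ∃ λ f → f ∈ˡ matching × ∃ λ x → x isEndOf e × x isEndOf f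
    touched e with matchedEnd (Edge.joined e)
    ... | inj₁ m with f , f∈M , x∈f ← matched-touched _ m = f , f∈M , _ , inj₁ refl , x∈f
    ... | inj₂ m with f , f∈M , x∈f ← matched-touched _ m = f , f∈M , _ , inj₂ refl , x∈f

-- Division by 5, and the theorem

≤*5⇒/5≤ : ∀ {m} n → m ≤ n * 5 → m / 5 ≤ n
≤*5⇒/5≤ n m≤n*5 = ≤-trans (/-monoˡ-≤ 5 m≤n*5) (≤-reflexive (m*n/n≡m n 5))

3*[q*5]/5≡q*3 : ∀ q → 3 * (q * 5) / 5 ≡ q * 3
3*[q*5]/5≡q*3 q = trans (cong (_/ 5) (rearrange q)) (m*n/n≡m (q * 3) 5)
  where
  rearrange : ∀ q → 3 * (q * 5) ≡ q * 3 * 5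
  rearrange = solve-∀

proposition8 : (∀ (k : ℕ) (5≤k : 5 ≤ k) → HasInducedClaw (GP₂ k 5≤k))
    × (∀ (k : ℕ) (5≤k : 5 ≤ k) → 5 ∣ k →
    IsDominationNumber (GP₂ k 5≤k) (3 * k / 5)
    × IsEdgeDominationNumber (GP₂ k 5≤k) (3 * k / 5))
proposition8 = GP₂-claw , λ where
  -- Matching on the divisibility turns `k` into `q * 5`, the form that the lifted set and matching
  -- require.
  k@.(q * 5) 5≤k (divides-refl q) →
    ( ( dominatingSet q 5≤k , dominatingSet-dominating q 5≤k
      , trans (∣dominatingSet∣ q 5≤k) (sym (3*[q*5]/5≡q*3 q)))
    , λ { _ (S , dom , refl) → ≤*5⇒/5≤ ∣ S ∣ (dominating⇒≤ k 5≤k S dom) } )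
    , ( ( matching q 5≤k , matching-isMaximal q 5≤k
        , trans (length-tabulate {n = q * 3} _) (sym (3*[q*5]/5≡q*3 q)))
    , λ { _ (M , max , refl) → ≤*5⇒/5≤ (length M) (maximalMatching⇒≤ k 5≤k M max) } )
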